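{- Let $\tau > 0$ be a real number. The mapping $\mathbb{N} \to \mathbb{N}$, $x \mapsto \lfloor \tau x \rfloor$, is injective if and only if $\tau \geq 1$.
   Context: $\mathbb{N} = \{0,1,2,\dots\}$. -}

module Defs where

open import Axiom.ExcludedMiddle using (ExcludedMiddle)
open import Data.Empty using (⊥-elim)
open import Data.Integer.Base as ℤ using (ℤ; +_)
import Data.Integer.Properties as ℤ
open import Data.Nat.Base as ℕ using (ℕ; zero; suc)
import Data.Nat.Properties as ℕ
open import Data.Product using (∃; _×_; _,_; proj₁; proj₂)
open import Data.Rational.Base as ℚ using (ℚ; 0ℚ; 1ℚ; ½)
open import Data.Rational.Literals using () renaming (fromℤ to ℤ⇒ℚ)
import Data.Rational.Properties as ℚ
import Data.Rational.Solver as ℚSolver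
open import Data.Sum.Base using (inj₁; inj₂)
open import Level using (0ℓ)
open import Relation.Binary.Definitions using (tri<; tri≈; tri>)
open import Relation.Binary.PropositionalEquality
open import Relation.Nullary using (¬_; yes; no)

Eventually : (ℕ → Set) → Set
Eventually P = ∃ λ N → ∀ n → N ℕ.≤ n → P n

IsCauchy : (ℕ → ℚ) → Set
IsCauchy s = ∀ ε → 0ℚ ℚ.< ε →
  ∃ λ N → ∀ m n → N ℕ.≤ m → N ℕ.≤ n → ℚ.∣ s m ℚ.- s n ∣ ℚ.< ε

-- Real numbers, as Cauchy sequences of rationals. Different sequences may
-- represent the same real; the relations below depend only on the real.
record ℝ : Set where
  constructor mkℝ
  field
    seq    : ℕ → ℚ
    cauchy : IsCauchy seq

open ℝ public

infix 4 _<_ _≤_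

_<_ : ℝ → ℝ → Set
x < y = ∃ λ ε → 0ℚ ℚ.< ε × Eventually (λ n → seq x n ℚ.+ ε ℚ.≤ seq y n)

_≤_ : ℝ → ℝ → Set
x ≤ y = ¬ (y < x)

ℚ⇒ℝ : ℚ → ℝ
ℚ⇒ℝ q = mkℝ (λ _ → q) λ ε 0<ε → 0 , λ _ _ _ _ →
  subst (λ r → ℚ.∣ r ∣ ℚ.< ε) (sym (ℚ.+-inverseʳ q)) 0<ε

fromℤ : ℤ → ℝ
fromℤ z = ℚ⇒ℝ (ℤ⇒ℚ z)

fromℕ : ℕ → ℝ
fromℕ n = fromℤ (+ n)

0ℝ 1ℝ : ℝ
0ℝ = fromℕ 0
1ℝ = fromℕ 1

private
  half+half : ∀ ε → ½ ℚ.* ε ℚ.+ ½ ℚ.* ε ≡ ε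
  half+half ε = trans (sym (ℚ.*-distribʳ-+ ε ½ ½)) (ℚ.*-identityˡ ε)

  pos-* : ∀ {p q} → 0ℚ ℚ.< p → 0ℚ ℚ.< q → 0ℚ ℚ.< p ℚ.* q
  pos-* {p} {q} 0<p 0<q =
    ℚ.positive⁻¹ _ {{ℚ.pos*pos⇒pos p {{ℚ.positive 0<p}} q {{ℚ.positive 0<q}}}}

  divide : ∀ ε b → 0ℚ ℚ.< ε → 0ℚ ℚ.< b → ∃ λ δ → 0ℚ ℚ.< δ × b ℚ.* δ ≡ ε
  divide ε b 0<ε 0<b = b⁻¹ ℚ.* ε , pos-* 0<b⁻¹ 0<ε ,
    trans (sym (ℚ.*-assoc b b⁻¹ ε))
      (trans (cong (ℚ._* ε) (ℚ.*-inverseʳ b)) (ℚ.*-identityˡ ε))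
    where
    instance
      b-pos : ℚ.Positive b
      b-pos = ℚ.positive 0<b
      b-nz : ℚ.NonZero b
      b-nz = ℚ.pos⇒nonZero b
    b⁻¹ = ℚ.1/ b
    0<b⁻¹ : 0ℚ ℚ.< b⁻¹
    0<b⁻¹ = ℚ.positive⁻¹ b⁻¹ {{ℚ.1/pos⇒pos b}}

  bounded : ∀ x → ∃ λ b → 0ℚ ℚ.< b × Eventually (λ n → ℚ.∣ seq x n ∣ ℚ.≤ b)
  bounded x = 1ℚ ℚ.+ ℚ.∣ xN ∣ , 0<b , N , λ n N≤n → begin
    ℚ.∣ seq x n ∣                         ≡⟨ cong ℚ.∣_∣ (split (seq x n) xN) ⟩
    ℚ.∣ (seq x n ℚ.- xN) ℚ.+ xN ∣         ≤⟨ ℚ.∣p+q∣≤∣p∣+∣q∣ (seq x n ℚ.- xN) xN ⟩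
    ℚ.∣ seq x n ℚ.- xN ∣ ℚ.+ ℚ.∣ xN ∣     ≤⟨ ℚ.+-monoˡ-≤ ℚ.∣ xN ∣ (ℚ.<⇒≤ (close n N N≤n ℕ.≤-refl)) ⟩
    1ℚ ℚ.+ ℚ.∣ xN ∣                       ∎
    where
    open ℚ.≤-Reasoning
    open ℚSolver.+-*-Solver
    c = cauchy x 1ℚ (ℚ.positive⁻¹ 1ℚ)
    N = proj₁ c
    close = proj₂ c
    xN = seq x N
    split : ∀ p q → p ≡ (p ℚ.- q) ℚ.+ q
    split = solve 2 (λ p q → p := (p :- q) :+ q) refl
    0<b : 0ℚ ℚ.< 1ℚ ℚ.+ ℚ.∣ xN ∣
    0<b = ℚ.+-mono-<-≤ (ℚ.positive⁻¹ 1ℚ) (ℚ.0≤∣p∣ xN)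

  *-mono-<-bound : ∀ {p q b δ} → ℚ.∣ p ∣ ℚ.≤ b → 0ℚ ℚ.< b → ℚ.∣ q ∣ ℚ.< δ →
                   ℚ.∣ p ℚ.* q ∣ ℚ.< b ℚ.* δ
  *-mono-<-bound {p} {q} {b} {δ} p≤b 0<b q<δ = begin-strict
    ℚ.∣ p ℚ.* q ∣           ≡⟨ ℚ.∣p*q∣≡∣p∣*∣q∣ p q ⟩
    ℚ.∣ p ∣ ℚ.* ℚ.∣ q ∣     ≤⟨ ℚ.*-monoʳ-≤-nonNeg ℚ.∣ q ∣ {{ℚ.∣-∣-nonNeg q}} p≤b ⟩
    b ℚ.* ℚ.∣ q ∣           <⟨ ℚ.*-monoʳ-<-pos b {{ℚ.positive 0<b}} q<δ ⟩
    b ℚ.* δ                 ∎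
    where open ℚ.≤-Reasoning

  product-close : ∀ {p q r s a b δ η ε} →
    ℚ.∣ p ∣ ℚ.≤ a → 0ℚ ℚ.< a → ℚ.∣ q ℚ.- s ∣ ℚ.< δ → a ℚ.* δ ≡ ½ ℚ.* ε →
    ℚ.∣ s ∣ ℚ.≤ b → 0ℚ ℚ.< b → ℚ.∣ p ℚ.- r ∣ ℚ.< η → b ℚ.* η ≡ ½ ℚ.* ε →
    ℚ.∣ p ℚ.* q ℚ.- r ℚ.* s ∣ ℚ.< ε
  product-close {p} {q} {r} {s} {a} {b} {δ} {η} {ε} p≤a 0<a q-s<δ aδ s≤b 0<b p-r<η bη =
    begin-strict
    ℚ.∣ p ℚ.* q ℚ.- r ℚ.* s ∣
      ≡⟨ cong ℚ.∣_∣ (split p q r s) ⟩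
    ℚ.∣ p ℚ.* (q ℚ.- s) ℚ.+ s ℚ.* (p ℚ.- r) ∣
      ≤⟨ ℚ.∣p+q∣≤∣p∣+∣q∣ (p ℚ.* (q ℚ.- s)) (s ℚ.* (p ℚ.- r)) ⟩
    ℚ.∣ p ℚ.* (q ℚ.- s) ∣ ℚ.+ ℚ.∣ s ℚ.* (p ℚ.- r) ∣
      <⟨ ℚ.+-mono-< (*-mono-<-bound {p} {q ℚ.- s} p≤a 0<a q-s<δ)
                    (*-mono-<-bound {s} {p ℚ.- r} s≤b 0<b p-r<η) ⟩
    a ℚ.* δ ℚ.+ b ℚ.* η
      ≡⟨ cong₂ ℚ._+_ aδ bη ⟩
    ½ ℚ.* ε ℚ.+ ½ ℚ.* ε
      ≡⟨ half+half ε ⟩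
    ε ∎
    where
    open ℚ.≤-Reasoning
    open ℚSolver.+-*-Solver
    split : ∀ p q r s → p ℚ.* q ℚ.- r ℚ.* s ≡ p ℚ.* (q ℚ.- s) ℚ.+ s ℚ.* (p ℚ.- r)
    split = solve 4 (λ p q r s → p :* q :- r :* s := p :* (q :- s) :+ s :* (p :- r)) refl

  *-cauchy : ∀ x y → IsCauchy (λ n → seq x n ℚ.* seq y n)
  *-cauchy x y ε 0<ε = from-bounds (bounded x) (bounded y)
    where
    Modulus : Set
    Modulus = ∃ λ N → ∀ m n → N ℕ.≤ m → N ℕ.≤ n →
      ℚ.∣ seq x m ℚ.* seq y m ℚ.- seq x n ℚ.* seq y n ∣ ℚ.< ε
    0<½ε : 0ℚ ℚ.< ½ ℚ.* ε
    0<½ε = pos-* (ℚ.positive⁻¹ ½) 0<ε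
    module _ {a b N₁ N₂} (0<a : 0ℚ ℚ.< a) (x≤a : ∀ n → N₁ ℕ.≤ n → ℚ.∣ seq x n ∣ ℚ.≤ a)
             (0<b : 0ℚ ℚ.< b) (y≤b : ∀ n → N₂ ℕ.≤ n → ℚ.∣ seq y n ∣ ℚ.≤ b) where
      from-moduli : ∀ {δ η} → a ℚ.* δ ≡ ½ ℚ.* ε → b ℚ.* η ≡ ½ ℚ.* ε →
        (∃ λ N → ∀ m n → N ℕ.≤ m → N ℕ.≤ n → ℚ.∣ seq y m ℚ.- seq y n ∣ ℚ.< δ) →
        (∃ λ N → ∀ m n → N ℕ.≤ m → N ℕ.≤ n → ℚ.∣ seq x m ℚ.- seq x n ∣ ℚ.< η) →
        Modulus
      from-moduli {δ} {η} aδ bη (N₃ , y-close) (N₄ , x-close) = N , λ m n N≤m N≤n →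
        product-close {seq x m} {seq y m} {seq x n} {seq y n} {a} {b} {δ} {η} {ε}
          (x≤a m (ℕ.≤-trans N₁≤N N≤m)) 0<a
          (y-close m n (ℕ.≤-trans N₃≤N N≤m) (ℕ.≤-trans N₃≤N N≤n)) aδ
          (y≤b n (ℕ.≤-trans N₂≤N N≤n)) 0<b
          (x-close m n (ℕ.≤-trans N₄≤N N≤m) (ℕ.≤-trans N₄≤N N≤n)) bη
        where
        N = (N₁ ℕ.⊔ N₂) ℕ.⊔ (N₃ ℕ.⊔ N₄)
        N₁≤N : N₁ ℕ.≤ N
        N₁≤N = ℕ.≤-trans (ℕ.m≤m⊔n N₁ N₂) (ℕ.m≤m⊔n (N₁ ℕ.⊔ N₂) (N₃ ℕ.⊔ N₄))
        N₂≤N : N₂ ℕ.≤ N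
        N₂≤N = ℕ.≤-trans (ℕ.m≤n⊔m N₁ N₂) (ℕ.m≤m⊔n (N₁ ℕ.⊔ N₂) (N₃ ℕ.⊔ N₄))
        N₃≤N : N₃ ℕ.≤ N
        N₃≤N = ℕ.≤-trans (ℕ.m≤m⊔n N₃ N₄) (ℕ.m≤n⊔m (N₁ ℕ.⊔ N₂) (N₃ ℕ.⊔ N₄))
        N₄≤N : N₄ ℕ.≤ N
        N₄≤N = ℕ.≤-trans (ℕ.m≤n⊔m N₃ N₄) (ℕ.m≤n⊔m (N₁ ℕ.⊔ N₂) (N₃ ℕ.⊔ N₄))

      from-divisors :
        (∃ λ δ → 0ℚ ℚ.< δ × a ℚ.* δ ≡ ½ ℚ.* ε) →
        (∃ λ η → 0ℚ ℚ.< η × b ℚ.* η ≡ ½ ℚ.* ε) → Modulus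
      from-divisors (δ , 0<δ , aδ) (η , 0<η , bη) =
        from-moduli aδ bη (cauchy y δ 0<δ) (cauchy x η 0<η)

    from-bounds :
      (∃ λ a → 0ℚ ℚ.< a × Eventually (λ n → ℚ.∣ seq x n ∣ ℚ.≤ a)) →
      (∃ λ b → 0ℚ ℚ.< b × Eventually (λ n → ℚ.∣ seq y n ∣ ℚ.≤ b)) → Modulus
    from-bounds (a , 0<a , N₁ , x≤a) (b , 0<b , N₂ , y≤b) =
      from-divisors 0<a x≤a 0<b y≤b (divide (½ ℚ.* ε) a 0<½ε 0<a) (divide (½ ℚ.* ε) b 0<½ε 0<b)

infixl 7 _*_

_*_ : ℝ → ℝ → ℝ
x * y = mkℝ (λ n → seq x n ℚ.* seq y n) (*-cauchy x y)

infix 4 ⌊_⌋≐_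

-- ⌊ x ⌋ = z, as a relation: the floor of a real is not computable, so
-- a function ℝ → ℤ with this graph exists only classically.
⌊_⌋≐_ : ℝ → ℤ → Set
⌊ x ⌋≐ z = fromℤ z ≤ x × x < fromℤ (ℤ.suc z)

-- f is the mapping n ↦ ⌊ τ n ⌋ from ℕ to ℕ. For τ > 0 there is at most one
-- such f (floorMap-unique) and, by excluded middle, at least one
-- (floorMap-exists).
IsFloorMap : ℝ → (ℕ → ℕ) → Set
IsFloorMap τ f = ∀ n → ⌊ τ * fromℕ n ⌋≐ + f n

private
  ℤ⇒ℚ-mono-≤ : ∀ {z w} → z ℤ.≤ w → ℤ⇒ℚ z ℚ.≤ ℤ⇒ℚ w
  ℤ⇒ℚ-mono-≤ z≤w = ℚ.*≤* (ℤ.*-monoʳ-≤-nonNeg (+ 1) z≤w)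

  <-ℤ-trans : ∀ {x z w} → x < fromℤ z → z ℤ.≤ w → x < fromℤ w
  <-ℤ-trans (ε , 0<ε , N , h) z≤w =
    ε , 0<ε , N , λ n N≤n → ℚ.≤-trans (h n N≤n) (ℤ⇒ℚ-mono-≤ z≤w)

⌊⌋-unique : ∀ {x z w} → ⌊ x ⌋≐ z → ⌊ x ⌋≐ w → z ≡ w
⌊⌋-unique {x} {z} {w} (z≤x , x<z+1) (w≤x , x<w+1) with ℤ.<-cmp z w
... | tri≈ _ z≡w _ = z≡w
... | tri< z<w _ _ = ⊥-elim (w≤x (<-ℤ-trans {x} x<z+1 (ℤ.i<j⇒suc[i]≤j z<w)))
... | tri> _ _ w<z = ⊥-elim (z≤x (<-ℤ-trans {x} x<w+1 (ℤ.i<j⇒suc[i]≤j w<z)))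

floorMap-unique : ∀ {τ f g} → IsFloorMap τ f → IsFloorMap τ g → ∀ n → f n ≡ g n
floorMap-unique {τ} hf hg n = ℤ.+-injective (⌊⌋-unique {τ * fromℕ n} (hf n) (hg n))

private
  ≤∣numerator∣ : ∀ q → q ℚ.≤ ℤ⇒ℚ (+ ℤ.∣ ℚ.↥ q ∣)
  ≤∣numerator∣ q@(ℚ.mkℚ n d-1 _) = ℚ.*≤* (begin
    n ℤ.* + 1                    ≡⟨ ℤ.*-identityʳ n ⟩
    n                            ≤⟨ n≤∣n∣ n ⟩
    + ℤ.∣ n ∣                    ≤⟨ ℤ.+≤+ (ℕ.m≤m*n ℤ.∣ n ∣ (suc d-1)) ⟩
    + (ℤ.∣ n ∣ ℕ.* suc d-1)      ≡⟨ ℤ.pos-* ℤ.∣ n ∣ (suc d-1) ⟩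
    + ℤ.∣ n ∣ ℤ.* + suc d-1      ∎)
    where
    open ℤ.≤-Reasoning
    n≤∣n∣ : ∀ i → i ℤ.≤ + ℤ.∣ i ∣
    n≤∣n∣ (+ _) = ℤ.≤-refl
    n≤∣n∣ ℤ.-[1+ _ ] = ℤ.-≤+

  p≤∣p∣ : ∀ p → p ℚ.≤ ℚ.∣ p ∣
  p≤∣p∣ p with ℚ.≤-total 0ℚ p
  ... | inj₁ 0≤p = ℚ.≤-reflexive (sym (ℚ.0≤p⇒∣p∣≡p 0≤p))
  ... | inj₂ p≤0 = ℚ.≤-trans p≤0 (ℚ.0≤∣p∣ p)

  archimedean : ∀ x → ∃ λ k → x < fromℕ k
  archimedean x = from-bound (bounded x)
    where
    from-bound : (∃ λ b → 0ℚ ℚ.< b × Eventually (λ n → ℚ.∣ seq x n ∣ ℚ.≤ b)) →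
                 ∃ λ k → x < fromℕ k
    from-bound (b , _ , N , x≤b) =
      ℤ.∣ ℚ.↥ (b ℚ.+ 1ℚ) ∣ , 1ℚ , ℚ.positive⁻¹ 1ℚ , N , λ n N≤n →
        ℚ.≤-trans (ℚ.+-monoˡ-≤ 1ℚ (ℚ.≤-trans (p≤∣p∣ (seq x n)) (x≤b n N≤n)))
                  (≤∣numerator∣ (b ℚ.+ 1ℚ))

  floor-below : ExcludedMiddle 0ℓ → ∀ x → 0ℝ ≤ x → ∀ k → x < fromℕ k →
                ∃ λ n → ⌊ x ⌋≐ + n
  floor-below em x 0≤x zero    x<0 = ⊥-elim (0≤x x<0)
  floor-below em x 0≤x (suc k) x<k+1 with em {x < fromℕ k}
  ... | yes x<k = floor-below em x 0≤x k x<k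
  ... | no  k≤x = k , k≤x , x<k+1

  0≤τn : ∀ {τ} → 0ℝ < τ → ∀ n → 0ℝ ≤ τ * fromℕ n
  0≤τn {τ} (ε , 0<ε , N , ε≤τ) n (δ , 0<δ , M , τn≤-δ) = ℚ.<-irrefl refl (begin-strict
    0ℚ                          <⟨ 0<δ ⟩
    δ                           ≡⟨ sym (ℚ.+-identityˡ δ) ⟩
    0ℚ ℚ.+ δ                    ≤⟨ ℚ.+-monoˡ-≤ δ 0≤prod ⟩
    seq τ k ℚ.* n' ℚ.+ δ        ≤⟨ τn≤-δ k (ℕ.m≤n⊔m N M) ⟩
    0ℚ                          ∎)
    where
    open ℚ.≤-Reasoning
    k = N ℕ.⊔ M
    n' = ℤ⇒ℚ (+ n)
    0≤τk : 0ℚ ℚ.≤ seq τ k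
    0≤τk = ℚ.≤-trans (ℚ.<⇒≤ 0<ε)
      (ℚ.≤-trans (ℚ.≤-reflexive (sym (ℚ.+-identityˡ ε))) (ε≤τ k (ℕ.m≤m⊔n N M)))
    0≤prod : 0ℚ ℚ.≤ seq τ k ℚ.* n'
    0≤prod = ℚ.≤-trans (ℚ.≤-reflexive (sym (ℚ.*-zeroˡ n')))
      (ℚ.*-monoʳ-≤-nonNeg n' {{ℚ.nonNegative (ℤ⇒ℚ-mono-≤ (ℤ.+≤+ ℕ.z≤n))}} 0≤τk)

floorMap-exists : ExcludedMiddle 0ℓ → ∀ {τ} → 0ℝ < τ → ∃ (IsFloorMap τ)
floorMap-exists em {τ} 0<τ = (λ n → proj₁ (floor n)) , (λ n → proj₂ (floor n))
  where
  nonNeg-floor : ∀ x → 0ℝ ≤ x → (∃ λ k → x < fromℕ k) → ∃ λ m → ⌊ x ⌋≐ + m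
  nonNeg-floor x 0≤x (k , x<k) = floor-below em x 0≤x k x<k
  floor : ∀ n → ∃ λ m → ⌊ τ * fromℕ n ⌋≐ + m
  floor n = nonNeg-floor (τ * fromℕ n) (0≤τn {τ} 0<τ n) (archimedean (τ * fromℕ n))

{-# OPTIONS --safe #-}

-- If τ ≥ 1 then τ (n + 1) ≥ τ n + 1, so consecutive floors differ by at
-- least 1 and the map is strictly increasing. If τ < 1 then 0 and 1 both
-- have floor 0. Excluded middle is not needed: x ≤ y is a negation, but since
-- the order of ℚ is decidable, comparing late enough terms of the Cauchy
-- sequences turns it into an eventual inequality up to any ε.

module Submission where

open import Defs
open import Data.Integer.Base as ℤ using (+_)
import Data.Integer.Properties as ℤ
open import Data.Nat.Base as ℕ using (ℕ; suc)
import Data.Nat.Properties as ℕ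
open import Data.Product using (∃; _×_; _,_; proj₁; proj₂)
open import Data.Rational.Base as ℚ using (ℚ; 0ℚ; 1ℚ)
open import Data.Rational.Literals using () renaming (fromℤ to ℤ⇒ℚ)
import Data.Rational.Properties as ℚ
import Data.Rational.Solver as ℚSolver
import Data.Rational.Unnormalised.Base as ℚᵘ
import Data.Rational.Unnormalised.Properties as ℚᵘ
open import Data.Sum.Base using (inj₁; inj₂)
open import Function.Bundles using (_⇔_; mk⇔)
open import Function.Definitions using (Injective)
open import Relation.Binary.Definitions using (tri<; tri≈; tri>)
open import Relation.Binary.PropositionalEquality using (_≡_; refl; sym; trans; cong; cong₂)
open import Relation.Nullary using (Dec; yes; no; contradiction)

ℕ⇒ℚ : ℕ → ℚ
ℕ⇒ℚ n = ℤ⇒ℚ (+ n)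

ℕ⇒ℚ-mono-≤ : ∀ {m n} → m ℕ.≤ n → ℕ⇒ℚ m ℚ.≤ ℕ⇒ℚ n
ℕ⇒ℚ-mono-≤ m≤n = ℚ.*≤* (ℤ.*-monoʳ-≤-nonNeg (+ 1) (ℤ.+≤+ m≤n))

-- Addition in ℚ reduces by a gcd, which is stuck on a variable `n`; among unnormalised fractions
-- cross-multiplication suffices.
ℕ⇒ℚ-suc : ∀ n → ℕ⇒ℚ (suc n) ≡ 1ℚ ℚ.+ ℕ⇒ℚ n
ℕ⇒ℚ-suc n = ℚ.toℚᵘ-injective (ℚᵘ.≃-trans
  (ℚᵘ.*≡* (cong (λ i → (+ 1 ℤ.+ i) ℤ.* + 1) (sym (ℤ.*-identityʳ (+ n)))))
  (ℚᵘ.≃-sym (ℚ.toℚᵘ-homo-+ 1ℚ (ℕ⇒ℚ n))))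

p≤∣p∣ : ∀ p → p ℚ.≤ ℚ.∣ p ∣
p≤∣p∣ p with ℚ.≤-total 0ℚ p
... | inj₁ 0≤p = ℚ.≤-reflexive (sym (ℚ.0≤p⇒∣p∣≡p 0≤p))
... | inj₂ p≤0 = ℚ.≤-trans p≤0 (ℚ.0≤∣p∣ p)

∣p-q∣<r⇒p<q+r : ∀ p q {r} → ℚ.∣ p ℚ.- q ∣ ℚ.< r → p ℚ.< q ℚ.+ r
∣p-q∣<r⇒p<q+r p q {r} close = begin-strict
  p                    ≡⟨ solve 2 (λ p q → p := q :+ (p :- q)) refl p q ⟩
  q ℚ.+ (p ℚ.- q)      <⟨ ℚ.+-monoʳ-< q (ℚ.≤-<-trans (p≤∣p∣ (p ℚ.- q)) close) ⟩
  q ℚ.+ r              ∎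
  where
  open ℚ.≤-Reasoning
  open ℚSolver.+-*-Solver

-- Of the three δ, one is the margin that x < y demands; the others are Cauchy errors.
≤⇒eventually-<-3δ : ∀ {q x} → ℚ⇒ℝ q ≤ x → ∀ {δ} → 0ℚ ℚ.< δ →
                    Eventually (λ n → q ℚ.< seq x n ℚ.+ (δ ℚ.+ δ ℚ.+ δ))
≤⇒eventually-<-3δ {q} {x} q≤x {δ} 0<δ = from-modulus (cauchy x δ 0<δ)
  where
  open ℚ.≤-Reasoning
  open ℚSolver.+-*-Solver
  Goal = Eventually (λ n → q ℚ.< seq x n ℚ.+ (δ ℚ.+ δ ℚ.+ δ))
  from-modulus : (∃ λ N → ∀ m n → N ℕ.≤ m → N ℕ.≤ n → ℚ.∣ seq x m ℚ.- seq x n ∣ ℚ.< δ) →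
                 Goal
  -- One decidable test at the index `N` settles all later ones: a gap of 2δ below `q` there leaves
  -- a gap of δ for every later term, so x < q; a smaller gap grows to at most 3δ.
  from-modulus (N , close) = compare (seq x N ℚ.+ δ ℚ.+ δ ℚ.≤? q)
    where
    compare : Dec (seq x N ℚ.+ δ ℚ.+ δ ℚ.≤ q) → Goal
    compare (yes far) = contradiction (δ , 0<δ , N , λ n N≤n → begin
      seq x n ℚ.+ δ
        ≤⟨ ℚ.+-monoˡ-≤ δ
             (ℚ.<⇒≤ (∣p-q∣<r⇒p<q+r (seq x n) (seq x N) (close n N N≤n ℕ.≤-refl))) ⟩
      seq x N ℚ.+ δ ℚ.+ δ
        ≤⟨ far ⟩
      q ∎) q≤x
    compare (no near) = N , λ n N≤n → begin-strict
      q
        <⟨ ℚ.≰⇒> near ⟩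
      seq x N ℚ.+ δ ℚ.+ δ
        <⟨ ℚ.+-monoˡ-< δ (ℚ.+-monoˡ-< δ
             (∣p-q∣<r⇒p<q+r (seq x N) (seq x n) (close N n ℕ.≤-refl N≤n))) ⟩
      seq x n ℚ.+ δ ℚ.+ δ ℚ.+ δ
        ≡⟨ solve 2 (λ p d → p :+ d :+ d :+ d := p :+ (d :+ d :+ d)) refl (seq x n) δ ⟩
      seq x n ℚ.+ (δ ℚ.+ δ ℚ.+ δ) ∎

-- Two eventual lower bounds, each with error 3δ, will be added against a single margin ε.
sixth : ∀ {ε} → 0ℚ ℚ.< ε →
        ∃ λ δ → 0ℚ ℚ.< δ × (δ ℚ.+ δ ℚ.+ δ) ℚ.+ (δ ℚ.+ δ ℚ.+ δ) ≡ ε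
-- The sum of six copies of `⅙` evaluates to `1ℚ` by computation.
sixth {ε} 0<ε = ⅙ ℚ.* ε , 0<⅙ε , trans (factor ⅙ ε) (ℚ.*-identityˡ ε)
  where
  open ℚSolver.+-*-Solver
  ⅙ = + 1 ℚ./ 6
  0<⅙ε : 0ℚ ℚ.< ⅙ ℚ.* ε
  0<⅙ε = ℚ.positive⁻¹ _ {{ℚ.pos*pos⇒pos ⅙ ε {{ℚ.positive 0<ε}}}}
  factor : ∀ c e → (c ℚ.* e ℚ.+ c ℚ.* e ℚ.+ c ℚ.* e) ℚ.+ (c ℚ.* e ℚ.+ c ℚ.* e ℚ.+ c ℚ.* e)
                   ≡ ((c ℚ.+ c ℚ.+ c) ℚ.+ (c ℚ.+ c ℚ.+ c)) ℚ.* e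
  factor = solve 2 (λ c e → (c :* e :+ c :* e :+ c :* e) :+ (c :* e :+ c :* e :+ c :* e)
                            := ((c :+ c :+ c) :+ (c :+ c :+ c)) :* e) refl

-- If n ≤ m, the margin of x below n is also one below m, against m ≤ x.
⌊⌋-least : ∀ {x m n} → ⌊ x ⌋≐ + m → x < fromℕ n → m ℕ.< n
⌊⌋-least {m = m} {n} (m≤x , _) (ε , 0<ε , N , x+ε≤n) = ℕ.≰⇒> λ n≤m →
  m≤x (ε , 0<ε , N , λ k N≤k → ℚ.≤-trans (x+ε≤n k N≤k) (ℕ⇒ℚ-mono-≤ n≤m))

<1⇒floor≡0 : ∀ {x m} → ⌊ x ⌋≐ + m → x < 1ℝ → m ≡ 0
<1⇒floor≡0 {x} ⌊x⌋ x<1 = ℕ.n<1⇒n≡0 (⌊⌋-least {x} ⌊x⌋ x<1)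

τ*0<1 : ∀ τ → τ * 0ℝ < 1ℝ
τ*0<1 τ = 1ℚ , ℚ.positive⁻¹ 1ℚ , 0 , λ k _ →
  ℚ.≤-reflexive (cong (ℚ._+ 1ℚ) (ℚ.*-zeroʳ (seq τ k)))

τ*1<1 : ∀ {τ} → τ < 1ℝ → τ * 1ℝ < 1ℝ
τ*1<1 {τ} (ε , 0<ε , N , τ+ε≤1) = ε , 0<ε , N , λ k N≤k →
  ℚ.≤-trans (ℚ.≤-reflexive (cong (ℚ._+ ε) (ℚ.*-identityʳ (seq τ k)))) (τ+ε≤1 k N≤k)

injective⇒1≤τ : ∀ {τ f} → IsFloorMap τ f → Injective _≡_ _≡_ f → 1ℝ ≤ τ
injective⇒1≤τ {τ} {f} floor inj τ<1 = contradiction (inj f0≡f1) λ ()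
  where
  f0≡f1 : f 0 ≡ f 1
  f0≡f1 = trans (<1⇒floor≡0 {τ * 0ℝ} (floor 0) (τ*0<1 τ))
            (sym (<1⇒floor≡0 {τ * 1ℝ} (floor 1) (τ*1<1 {τ} τ<1)))

1≤τ⇒f[n]<f[1+n] : ∀ {τ f} → IsFloorMap τ f → 1ℝ ≤ τ → ∀ n → f n ℕ.< f (suc n)
1≤τ⇒f[n]<f[1+n] {τ} {f} floor 1≤τ n = from-margin (proj₂ (floor (suc n)))
  where
  Goal = f n ℕ.< f (suc n)
  from-moduli : ∀ {ε δ} → δ ℚ.+ δ ≡ ε →
    Eventually (λ k → seq τ k ℚ.* ℕ⇒ℚ (suc n) ℚ.+ ε ℚ.≤ ℕ⇒ℚ (suc (f (suc n)))) →
    Eventually (λ k → 1ℚ ℚ.< seq τ k ℚ.+ δ) →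
    Eventually (λ k → ℕ⇒ℚ (f n) ℚ.< seq τ k ℚ.* ℕ⇒ℚ n ℚ.+ δ) →
    Goal
  from-moduli {ε} {δ} δ+δ≡ε (N₁ , τ[1+n]+ε≤f+1) (N₂ , 1<τ+δ) (N₃ , fn<τn+δ) =
    -- Otherwise, at a late index `k`, 1 + f n < t (n + 1) + ε ≤ f (n + 1) + 1 ≤ 1 + f n. The strict
    -- first step comes from adding the approximate forms of 1 ≤ τ and f n ≤ τ n.
    ℕ.≰⇒> λ f[1+n]≤fn → ℚ.<-irrefl refl (begin-strict
      1ℚ ℚ.+ ℕ⇒ℚ (f n)
        <⟨ ℚ.+-mono-< (1<τ+δ k N₂≤k) (fn<τn+δ k N₃≤k) ⟩
      (t ℚ.+ δ) ℚ.+ (t ℚ.* ℕ⇒ℚ n ℚ.+ δ)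
        ≡⟨ solve 3 (λ t m d → (t :+ d) :+ (t :* m :+ d)
                              := t :* (con 1ℚ :+ m) :+ (d :+ d)) refl t (ℕ⇒ℚ n) δ ⟩
      t ℚ.* (1ℚ ℚ.+ ℕ⇒ℚ n) ℚ.+ (δ ℚ.+ δ)
        ≡⟨ cong₂ (λ m e → t ℚ.* m ℚ.+ e) (sym (ℕ⇒ℚ-suc n)) δ+δ≡ε ⟩
      t ℚ.* ℕ⇒ℚ (suc n) ℚ.+ ε
        ≤⟨ τ[1+n]+ε≤f+1 k N₁≤k ⟩
      ℕ⇒ℚ (suc (f (suc n)))
        ≤⟨ ℕ⇒ℚ-mono-≤ (ℕ.s≤s f[1+n]≤fn) ⟩
      ℕ⇒ℚ (suc (f n))
        ≡⟨ ℕ⇒ℚ-suc (f n) ⟩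
      1ℚ ℚ.+ ℕ⇒ℚ (f n) ∎)
    where
    open ℚ.≤-Reasoning
    open ℚSolver.+-*-Solver
    k = N₁ ℕ.⊔ N₂ ℕ.⊔ N₃
    t = seq τ k
    N₁≤k : N₁ ℕ.≤ k
    N₁≤k = ℕ.≤-trans (ℕ.m≤m⊔n N₁ N₂) (ℕ.m≤m⊔n (N₁ ℕ.⊔ N₂) N₃)
    N₂≤k : N₂ ℕ.≤ k
    N₂≤k = ℕ.≤-trans (ℕ.m≤n⊔m N₁ N₂) (ℕ.m≤m⊔n (N₁ ℕ.⊔ N₂) N₃)
    N₃≤k : N₃ ℕ.≤ k
    N₃≤k = ℕ.m≤n⊔m (N₁ ℕ.⊔ N₂) N₃

  from-margin : τ * fromℕ (suc n) < fromℕ (suc (f (suc n))) → Goal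
  -- The strict upper bound in the floor at n + 1 supplies ε. The `δ` of `from-moduli` is half of
  -- it, three of the sixths chosen here.
  from-margin (ε , 0<ε , τ[1+n]+ε≤f+1) = from-sixth (sixth 0<ε)
    where
    from-sixth : (∃ λ δ → 0ℚ ℚ.< δ × (δ ℚ.+ δ ℚ.+ δ) ℚ.+ (δ ℚ.+ δ ℚ.+ δ) ≡ ε) → Goal
    from-sixth (δ , 0<δ , 6δ≡ε) = from-moduli 6δ≡ε τ[1+n]+ε≤f+1
      (≤⇒eventually-<-3δ {x = τ} 1≤τ 0<δ)
      (≤⇒eventually-<-3δ {x = τ * fromℕ n} (proj₁ (floor n)) 0<δ)

module _ {f : ℕ → ℕ} (step : ∀ n → f n ℕ.< f (suc n)) where

  step⇒mono-< : ∀ {m n} → m ℕ.< n → f m ℕ.< f n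
  -- `≤′` is built by raising the upper end by one, which matches `step`.
  step⇒mono-< {m} m<n = go (ℕ.≤⇒≤′ m<n)
    where
    go : ∀ {n} → suc m ℕ.≤′ n → f m ℕ.< f n
    go ℕ.≤′-refl       = step m
    go (ℕ.≤′-step m<n) = ℕ.<-trans (go m<n) (step _)

  step⇒injective : Injective _≡_ _≡_ f
  step⇒injective {m} {n} fm≡fn with ℕ.<-cmp m n
  ... | tri< m<n _ _ = contradiction fm≡fn (ℕ.<⇒≢ (step⇒mono-< m<n))
  ... | tri≈ _ m≡n _ = m≡n
  ... | tri> _ _ n<m = contradiction (sym fm≡fn) (ℕ.<⇒≢ (step⇒mono-< n<m))

proposition6 : (τ : ℝ) → 0ℝ < τ →
    (f : ℕ → ℕ) → IsFloorMap τ f →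
    Injective _≡_ _≡_ f ⇔ 1ℝ ≤ τ
proposition6 τ _ f floor = mk⇔
  (injective⇒1≤τ {τ} floor)
  (λ 1≤τ → step⇒injective (1≤τ⇒f[n]<f[1+n] {τ} floor 1≤τ))
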